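{- Let $G$ be a comb and let $D$ be an oriented graph missing $G$. Then $D$ has a vertex $v$ with $d^{+}_D(v)\le d^{++}_D(v)$.
   Context: Graphs and digraphs are finite, with nonempty vertex set in the case of $D$; graphs are simple. An oriented graph is a digraph without loops, parallel arcs or digons (directed cycles of length 2). For a vertex $v$ of an oriented graph $D$, $N^{+}_D(v)$ is the set of out-neighbors of $v$ and $d^{+}_D(v)=|N^{+}_D(v)|$. $N^{++}_D(v)$ is the second out-neighborhood: the set of vertices at distance exactly 2 from $v$, i.e. the out-neighbors of out-neighbors of $v$, excluding $N^{+}_D(v)$; $d^{++}_D(v)=|N^{++}_D(v)|$. A missing edge of $D$ is an unordered pair $xy$ of distinct vertices with $(x,y)\notin E(D)$ and $(y,x)\notin E(D)$. $D$ is missing a graph $G$ if $V(G)\subseteq V(D)$ and $E(G)$ is exactly the set of missing edges of $D$ (isolated vertices of $G$ are allowed). A chair is a graph on 5 distinct vertices $x,y,z,t,v$ whose edges are exactly $xy,yz,zt,zv$; the co-chair is its complement. $C_n$ is the cycle on $n$ vertices and $\overline{H}$ is the complement of $H$. A comb is a graph having no induced subgraph isomorphic to $C_4$, $\overline{C_4}$, $C_5$, chair or co-chair. -}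

module Defs where

open import Data.Fin.Base using (Fin; toℕ)
open import Data.Fin.Patterns using (0F; 1F; 2F; 3F; 4F)
open import Data.Fin.Properties using (any?)
open import Data.Fin.Subset using (Subset; _∈_; ∣_∣)
open import Data.Nat.Base using (ℕ; suc; _%_; NonZero)
open import Data.Product.Base using (Σ; ∃; _×_; _,_; proj₁; map)
open import Data.Vec.Base using (tabulate)
open import Function.Base using (_∘_)
open import Function.Bundles using (_⇔_)
open import Function.Definitions using (Injective)
open import Relation.Binary.Construct.Closure.Symmetric
  using (SymClosure; fwd; bwd; symmetric)
open import Relation.Binary.Core using (Rel)
open import Relation.Binary.Definitions
  using (Symmetric; Irreflexive; Asymmetric; Decidable)
open import Relation.Binary.PropositionalEquality using (_≡_; _≢_; refl; ≢-sym)
open import Relation.Nullary using (¬_; does)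
open import Relation.Nullary.Decidable using (_×-dec_; ¬?)
import Relation.Unary as U

record Graph (V : Set) : Set₁ where
  field
    Adj    : V → V → Set
    sym    : Symmetric Adj
    irrefl : Irreflexive _≡_ Adj

open Graph public

complement : ∀ {V} → Graph V → Graph V
complement G .Adj x y                 = x ≢ y × ¬ Adj G x y
complement G .sym (x≢y , ¬xy)         = ≢-sym x≢y , ¬xy ∘ sym G
complement G .irrefl x≡y (x≢y , _)    = x≢y x≡y

-- An induced subgraph of G isomorphic to H, presented by the isomorphism from
-- H onto it: its vertex set is the image of f.
record InducedCopy {W V : Set} (H : Graph W) (G : Graph V) : Set where
  field
    f         : W → V
    injective : Injective _≡_ _≡_ f
    adj       : ∀ a b → Adj H a b ⇔ Adj G (f a) (f b)

-- The usual cycle for n ≥ 3.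
cycle : (n : ℕ) .{{_ : NonZero n}} → Graph (Fin n)
cycle n = record
  { Adj    = λ i j → i ≢ j × SymClosure Next i j
  ; sym    = map ≢-sym (symmetric Next)
  ; irrefl = λ i≡j i~j → proj₁ i~j i≡j
  }
  where
  Next : Rel (Fin n) _
  Next i j = toℕ j ≡ suc (toℕ i) % n

-- The vertices x, y, z, t, v are numbered 0, 1, 2, 3, 4.
data ChairEdge : Fin 5 → Fin 5 → Set where
  xy : ChairEdge 0F 1F
  yz : ChairEdge 1F 2F
  zt : ChairEdge 2F 3F
  zv : ChairEdge 2F 4F

chair : Graph (Fin 5)
chair .Adj                = SymClosure ChairEdge
chair .sym                = symmetric ChairEdge
chair .irrefl refl (fwd ())
chair .irrefl refl (bwd ())

record IsComb {V : Set} (G : Graph V) : Set where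
  field
    C₄-free       : ¬ InducedCopy (cycle 4) G
    co-C₄-free    : ¬ InducedCopy (complement (cycle 4)) G
    C₅-free       : ¬ InducedCopy (cycle 5) G
    chair-free    : ¬ InducedCopy chair G
    co-chair-free : ¬ InducedCopy (complement chair) G

record Digraph (n : ℕ) : Set₁ where
  field
    Arc  : Fin n → Fin n → Set
    arc? : Decidable Arc

-- Parallel arcs are already excluded, since arcs form a relation.
record IsOriented {n : ℕ} (D : Digraph n) : Set where
  open Digraph D
  field
    loopless  : Irreflexive _≡_ Arc
    digonless : Asymmetric Arc

⟦_⟧ : ∀ {n} {P : Fin n → Set} → U.Decidable P → Subset n
⟦ P? ⟧ = tabulate (does ∘ P?)

module _ {n : ℕ} (D : Digraph n) where
  open Digraph D

  N⁺ : Fin n → Subset n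
  N⁺ v = ⟦ arc? v ⟧

  -- In an oriented graph v itself is never included, as v → u → v is a digon.
  N⁺⁺ : Fin n → Subset n
  N⁺⁺ v = ⟦ (λ w → any? (λ u → arc? v u ×-dec arc? u w) ×-dec ¬? (arc? v w)) ⟧

  d⁺ : Fin n → ℕ
  d⁺ v = ∣ N⁺ v ∣

  d⁺⁺ : Fin n → ℕ
  d⁺⁺ v = ∣ N⁺⁺ v ∣

  MissingEdge : Fin n → Fin n → Set
  MissingEdge x y = x ≢ y × ¬ Arc x y × ¬ Arc y x

  -- S is the vertex set of G, so the inclusion V(G) ⊆ V(D) is built in.
  IsMissing : (S : Subset n) → Graph (∃ (_∈ S)) → Set
  IsMissing S G = ∀ x y →
    MissingEdge x y ⇔ (Σ (x ∈ S) λ p → Σ (y ∈ S) λ q → Adj G (x , p) (y , q))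

{-# OPTIONS --safe #-}

-- A missing edge ab is oriented a ⇝ b when this is convenient (every in-neighbour
-- of a reaches b within two steps).  An edge admitting neither orientation is
-- beaten by another missing edge xy, and inherits an orientation of xy; in a comb
-- two such edges are the end edges of an induced path on four vertices, which makes
-- this inheritance acyclic.  If both orientations are justified, both are kept.
-- Let f be the last vertex of a local median order of the resulting semicomplete
-- digraph.  The counting argument of Havet and Thomassé bounds d⁺ f by the number
-- of vertices v ∉ N⁺ f with f → a ⇝ v.  Such a v outside N⁺⁺ f occurs only when av
-- inherits its orientation from an edge fy with y in N⁺⁺ f; different v have
-- different y, and y can be left out of the count, because all the vertices z at
-- which the argument is cut satisfy z ⇝ y.

module Submission where

open import Defs
open import Data.Bool.Base using (Bool; true; false; if_then_else_)
open import Data.Empty using (⊥; ⊥-elim)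
open import Data.Fin.Base using (Fin; zero; suc; toℕ; combine; remQuot) renaming (_<_ to _<ᶠ_)
open import Data.Fin.Induction using (spo-wellFounded)
open import Data.Fin.Patterns using (0F; 1F; 2F; 3F; 4F)
open import Data.Fin.Properties using (_≟_; any?; all?; <-cmp; remQuot-combine)
open import Data.Fin.Subset using (Subset; _∈_; ∣_∣)
open import Data.List.Base using (List; []; _∷_; _++_; map; length; filter; allFin; tabulate)
import Data.List.Membership.Propositional as List
open import Data.List.Membership.Propositional.Properties
  using (∈-∃++; ∈-++⁺ˡ; ∈-++⁺ʳ; ∈-++⁻; ∈-filter⁺; ∈-filter⁻; ∈-allFin)
open import Data.List.Properties using (map-tabulate; length-tabulate)
open import Data.List.Relation.Binary.Permutation.Propositional
  using (_↭_; ↭-refl; ↭-sym; ↭-trans; ↭⇒↭ₛ; prep)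
open import Data.List.Relation.Binary.Permutation.Propositional.Properties
  using (shift; map⁺; ↭-length)
import Data.List.Relation.Binary.Permutation.Setoid.Properties as Permutation
open import Data.List.Relation.Unary.All as All using (All; []; _∷_)
open import Data.List.Relation.Unary.AllPairs using ([]; _∷_)
open import Data.List.Relation.Unary.Any using (here; there)
open import Data.List.Relation.Unary.Unique.Propositional using (Unique)
open import Data.List.Relation.Unary.Unique.Propositional.Properties using (allFin⁺; filter⁺)
open import Data.Nat.Base
  using (ℕ; zero; suc; _+_; _*_; _%_; _≤_; _<_; z≤n; s≤s; s<s⁻¹; NonZero; ≢-nonZero⁻¹)
open import Data.Nat.ListAction using (sum)
open import Data.Nat.ListAction.Properties using (sum-↭)
import Data.Nat.Properties as ℕ
open import Data.Nat.Properties
  using ( ≤-refl; ≤-trans; ≤-reflexive; <-≤-trans; _≤?_; ≰⇒>; ≤⇒≯; n≤1+n; m≤n⇒m≤1+n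
        ; m≤n+m; m≤m+n; m≤n⇒m≤n+o; m≤n⇒m≤o+n; +-assoc; +-identityʳ; +-suc; +-mono-≤
        ; +-mono-≤-<; +-monoˡ-<; +-monoʳ-<; +-monoˡ-≤; +-monoʳ-≤; +-cancelʳ-<; +-cancelʳ-≤
        ; *-monoʳ-≤; module ≤-Reasoning)
open import Data.Nat.Tactic.RingSolver using (solve-∀)
open import Data.Product.Base using (∃; ∃₂; _×_; _,_; proj₁; proj₂)
open import Data.Sum.Base using (_⊎_; inj₁; inj₂; [_,_]′; swap)
open import Data.Unit.Base using (⊤; tt)
import Data.Vec.Base as Vec
open import Data.Vec.Base using (Vec; []; _∷_)
open import Data.Vec.Properties.WithK using ([]=-irrelevant)
open import Function.Base using (_∘_; flip; id)
open import Function.Bundles using (mk⇔; Equivalence)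
open import Function.Definitions using (Injective)
open import Induction.WellFounded using (Acc; acc; WellFounded)
open import Relation.Binary.Construct.Closure.Symmetric using (SymClosure; fwd; bwd)
open import Relation.Binary.Construct.Closure.Transitive as Transitive
  using (TransClosure; [_]; _∷_; wellFounded⁻)
open import Relation.Binary.Definitions using (Decidable; tri<; tri≈; tri>)
open import Relation.Binary.PropositionalEquality as ≡
  using (_≡_; _≢_; refl; cong; subst; subst₂; ≢-sym; module ≡-Reasoning)
open import Relation.Nullary using (¬_; Dec; yes; no; does; contradiction)
open import Relation.Nullary.Decidable
  using (_×-dec_; _⊎-dec_; ¬?; map′; True; toWitness; decidable-stable)
import Relation.Unary as U

-- Counting and local median orders

module _ {A : Set} where

  total : (A → ℕ) → List A → ℕ
  total f = sum ∘ map f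

  total-↭ : ∀ f {l l′} → l ↭ l′ → total f l ≡ total f l′
  total-↭ f = sum-↭ ∘ map⁺ f

  total-+ : ∀ f g l → total (λ u → f u + g u) l ≡ total f l + total g l
  total-+ f g []      = refl
  total-+ f g (u ∷ l) rewrite total-+ f g l = lemma (f u) (g u) (total f l) (total g l)
    where
    lemma : ∀ a b c d → a + b + (c + d) ≡ a + c + (b + d)
    lemma = solve-∀

  total-mono : ∀ {f g} → (∀ u → f u ≤ g u) → ∀ l → total f l ≤ total g l
  total-mono f≤g []      = z≤n
  total-mono f≤g (u ∷ l) = +-mono-≤ (f≤g u) (total-mono f≤g l)

  -- The partner of the head is deleted from `ys`; by injectivity it is not the partner of any other
  -- entry of `xs`.
  length-injection : ∀ {B : Set} (W : A → B → Set) →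
    (∀ {x x′ y} → W x y → W x′ y → x ≡ x′) →
    ∀ {xs} ys → Unique xs → (∀ {x} → x List.∈ xs → ∃ λ y → y List.∈ ys × W x y) →
    length xs ≤ length ys
  length-injection W inj ys [] _ = z≤n
  length-injection W inj ys (x∉xs ∷ unique) partner
    with y , y∈ys , xWy ← partner (here refl)
    with l , r , refl ← ∈-∃++ y∈ys =
    ≤-trans (s≤s (length-injection W inj (l ++ r) unique partner′))
            (≤-reflexive (≡.sym (↭-length (shift y l r))))
    where
    partner′ : ∀ {x} → x List.∈ _ → ∃ λ y → y List.∈ l ++ r × W x y
    partner′ x∈xs with y′ , y′∈ys , xWy′ ← partner (there x∈xs) | ∈-++⁻ l y′∈ys
    ... | inj₁ y′∈l         = y′ , ∈-++⁺ˡ y′∈l , xWy′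
    ... | inj₂ (there y′∈r) = y′ , ∈-++⁺ʳ l y′∈r , xWy′
    ... | inj₂ (here refl)  = contradiction (inj xWy xWy′) (All.lookup x∉xs x∈xs)

indicator : {P : Set} → Dec P → ℕ
indicator d = if does d then 1 else 0

indicator-yes : ∀ {P} (d : Dec P) → P → indicator d ≡ 1
indicator-yes (yes _) _ = refl
indicator-yes (no ¬p) p = contradiction p ¬p

indicator-no : ∀ {P} (d : Dec P) → ¬ P → indicator d ≡ 0
indicator-no (no _)  _  = refl
indicator-no (yes p) ¬p = contradiction p ¬p

indicator≤1 : ∀ {P} (d : Dec P) → indicator d ≤ 1
indicator≤1 (yes _) = ≤-refl
indicator≤1 (no _)  = z≤n

indicator-difference : ∀ {P Q} (p? : Dec P) (q? : Dec Q) → (Q → P) →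
                       indicator (p? ×-dec ¬? q?) + indicator q? ≤ indicator p?
indicator-difference (yes _) (yes _) _   = ≤-refl
indicator-difference (yes _) (no _)  _   = ≤-refl
indicator-difference (no ¬p) (yes q) Q⇒P = contradiction (Q⇒P q) ¬p
indicator-difference (no _)  (no _)  _   = z≤n

length-filter≡total : ∀ {A : Set} {P : A → Set} (P? : U.Decidable P) l →
                      length (filter P? l) ≡ total (indicator ∘ P?) l
length-filter≡total P? []      = refl
length-filter≡total P? (u ∷ l) with P? u
... | yes _ = cong suc (length-filter≡total P? l)
... | no _  = length-filter≡total P? l

total-suc : ∀ {n} (f : Fin (suc n) → ℕ) → total (f ∘ suc) (allFin n) ≡ total f (tabulate suc)
total-suc f = cong sum (≡.trans (map-tabulate id (f ∘ suc)) (≡.sym (map-tabulate Fin.suc f)))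

∣tabulate∣ : ∀ {n} (b : Fin n → Bool) →
             ∣ Vec.tabulate b ∣ ≡ total (λ i → if b i then 1 else 0) (allFin n)
∣tabulate∣ {zero}  b = refl
∣tabulate∣ {suc n} b
  with b zero | ≡.trans (∣tabulate∣ (b ∘ suc)) (total-suc λ i → if b i then 1 else 0)
... | true  | ih = cong suc ih
... | false | ih = ih

total-injection : ∀ {n} {P Q : Fin n → Set} (P? : U.Decidable P) (Q? : U.Decidable Q)
  (W : Fin n → Fin n → Set) → (∀ {x x′ y} → W x y → W x′ y → x ≡ x′) →
  (∀ {x} → P x → ∃ λ y → Q y × W x y) →
  total (indicator ∘ P?) (allFin n) ≤ total (indicator ∘ Q?) (allFin n)
total-injection {n} P? Q? W inj partner =
  subst₂ _≤_ (length-filter≡total P? (allFin n)) (length-filter≡total Q? (allFin n))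
    (length-injection W inj _ (filter⁺ P? (allFin⁺ n)) λ x∈ →
      let y , Qy , xWy = partner (proj₂ (∈-filter⁻ P? {xs = allFin n} x∈))
      in  y , ∈-filter⁺ Q? (∈-allFin y) Qy , xWy)

-- Orders are listed backwards: the head of a list is the last vertex of the order.
module MedianOrder {A : Set} (e : A → A → ℕ) where

  in-weight out-weight : A → List A → ℕ
  in-weight v  = total (λ u → e u v)
  out-weight v = total (e v)

  weight : List A → ℕ
  weight []      = 0
  weight (v ∷ l) = in-weight v l + weight l

  -- `o` and `i` carry the weights leaving and entering `v` over the entries already passed. Started
  -- from zero, this is the feedback property for every interval ending at `v`.
  Balanced : A → ℕ → ℕ → List A → Set
  Balanced v o i []      = o ≤ i
  Balanced v o i (u ∷ l) = o ≤ i × Balanced v (o + e v u) (i + e u v) l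

  LocalMedian : List A → Set
  LocalMedian []      = ⊤
  LocalMedian (v ∷ l) = Balanced v 0 0 l × LocalMedian l

  -- Moving `v` from the end of the order back across `l` trades the weight from `l` into `v` for
  -- the weight from `v` into `l`. The additive form avoids subtraction.
  weight-move : ∀ v l r → weight (l ++ v ∷ r) + in-weight v l ≡ weight (v ∷ l ++ r) + out-weight v l
  weight-move v []      r = refl
  weight-move v (u ∷ l) r = begin
    in-weight u (l ++ v ∷ r) + weight (l ++ v ∷ r) + (e u v + in-weight v l)
      ≡⟨ cong (λ k → k + weight (l ++ v ∷ r) + (e u v + in-weight v l)) (total-↭ _ (shift v l r)) ⟩
    e v u + in-weight u (l ++ r) + weight (l ++ v ∷ r) + (e u v + in-weight v l)
      ≡⟨ lemma₁ (e v u) (in-weight u (l ++ r)) (weight (l ++ v ∷ r)) (e u v) (in-weight v l) ⟩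
    e v u + in-weight u (l ++ r) + e u v + (weight (l ++ v ∷ r) + in-weight v l)
      ≡⟨ cong (e v u + in-weight u (l ++ r) + e u v +_) (weight-move v l r) ⟩
    e v u + in-weight u (l ++ r) + e u v + (in-weight v (l ++ r) + weight (l ++ r) + out-weight v l)
      ≡⟨ lemma₂ (e v u) (in-weight u (l ++ r)) (e u v) (in-weight v (l ++ r))
                (weight (l ++ r)) (out-weight v l) ⟩
    e u v + in-weight v (l ++ r) + (in-weight u (l ++ r) + weight (l ++ r))
      + (e v u + out-weight v l) ∎
    where
    open ≡-Reasoning
    lemma₁ : ∀ a b c d f → a + b + c + (d + f) ≡ a + b + d + (c + f)
    lemma₁ = solve-∀
    lemma₂ : ∀ a b c d f g → a + b + c + (d + f + g) ≡ c + d + (b + f) + (a + g)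
    lemma₂ = solve-∀

  balanced? : ∀ v o i l → Balanced v o i l ⊎
    (∃₂ λ l₁ l₂ → l ≡ l₁ ++ l₂ × i + in-weight v l₁ < o + out-weight v l₁)
  balanced? v o i l with o ≤? i
  balanced? v o i l | no o≰i = inj₂ ([] , l , refl , +-monoˡ-< 0 (≰⇒> o≰i))
  balanced? v o i [] | yes o≤i = inj₁ o≤i
  balanced? v o i (u ∷ l) | yes o≤i with balanced? v (o + e v u) (i + e u v) l
  ... | inj₁ bal = inj₁ (o≤i , bal)
  ... | inj₂ (l₁ , l₂ , refl , i<o) = inj₂ (u ∷ l₁ , l₂ , refl ,
    subst₂ _<_ (+-assoc i (e u v) _) (+-assoc o (e v u) _) i<o)

  -- If balance fails on a prefix, moving the head across that prefix increases the weight.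
  improve : ∀ l → LocalMedian l ⊎ ∃ λ l′ → l′ ↭ l × weight l < weight l′
  improve [] = inj₁ tt
  improve (v ∷ l) with improve l
  ... | inj₂ (l′ , l′↭l , w<w′) = inj₂ (v ∷ l′ , prep v l′↭l ,
    +-mono-≤-< (≤-reflexive (total-↭ _ (↭-sym l′↭l))) w<w′)
  ... | inj₁ median with balanced? v 0 0 l
  ...   | inj₁ balanced = inj₁ (balanced , median)
  ...   | inj₂ (l₁ , l₂ , refl , in<out) = inj₂ (l₁ ++ v ∷ l₂ , shift v l₁ l₂ ,
    +-cancelʳ-< (in-weight v l₁) _ _
      (subst (weight (v ∷ l₁ ++ l₂) + in-weight v l₁ <_) (≡.sym (weight-move v l₁ l₂))
        (+-monoʳ-< (weight (v ∷ l₁ ++ l₂)) in<out)))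

  module _ (e≤1 : ∀ u v → e u v ≤ 1) where

    in-weight≤length : ∀ v l → in-weight v l ≤ length l
    in-weight≤length v []      = z≤n
    in-weight≤length v (u ∷ l) = +-mono-≤ (e≤1 u v) (in-weight≤length v l)

    weight≤length² : ∀ l → weight l ≤ length l * length l
    weight≤length² []      = z≤n
    weight≤length² (v ∷ l) = +-mono-≤ (m≤n⇒m≤1+n (in-weight≤length v l))
      (≤-trans (weight≤length² l) (*-monoʳ-≤ (length l) (n≤1+n (length l))))

    local-median : ∀ l → ∃ λ l′ → l′ ↭ l × LocalMedian l′
    local-median l₀ = go bound l₀ ↭-refl (m≤n+m bound (weight l₀))
      where
      bound : ℕ
      bound = length l₀ * length l₀

      -- `k` is fuel: it covers the gap between `weight l` and the bound, and each improvement
      -- narrows the gap by at least one.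
      go : ∀ k l → l ↭ l₀ → bound ≤ weight l + k → ∃ λ l′ → l′ ↭ l₀ × LocalMedian l′
      go k l l↭l₀ bound≤ with improve l
      ... | inj₁ median = l , l↭l₀ , median
      go zero l l↭l₀ bound≤ | inj₂ (l′ , l′↭l , w<w′) = contradiction
        (<-≤-trans w<w′ (subst (λ k → weight l′ ≤ k * k) (↭-length (↭-trans l′↭l l↭l₀))
                               (weight≤length² l′)))
        (≤⇒≯ (subst (bound ≤_) (+-identityʳ _) bound≤))
      go (suc k) l l↭l₀ bound≤ | inj₂ (l′ , l′↭l , w<w′) =
        go k l′ (↭-trans l′↭l l↭l₀)
          (≤-trans bound≤ (≤-trans (≤-reflexive (+-suc _ k)) (+-monoˡ-≤ k w<w′)))

  -- The list splits into intervals ending at cuts; on each of them, balance at the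
  -- end z of the interval turns fairness into total α ≤ total γ.  The arguments
  -- o, i, s, t are the sums over the part of the interval already traversed.
  module Feed (α γ : A → ℕ) (Cut : A → Set) (α-cut : ∀ {z} → Cut z → α z ≡ 0) (z₀ : A) where

    Fair : A → Set
    Fair u = ∀ {z} → z ≡ z₀ ⊎ Cut z → α u + e u z ≤ γ u + e z u

    feed : ∀ {z} → z ≡ z₀ ⊎ Cut z → ∀ l o i s t → s + i ≤ t + o → Balanced z o i l →
           LocalMedian l → All (λ u → Cut u ⊎ Fair u) l → s + total α l ≤ t + total γ l
    feed z∈ [] o i s t s+i≤t+o o≤i _ _ =
      -- At the end of an interval, balance `o ≤ i` turns the invariant into `s ≤ t`.
      +-monoˡ-≤ 0 (+-cancelʳ-≤ o s t (≤-trans (+-monoʳ-≤ s o≤i) s+i≤t+o))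
    feed z∈ (u ∷ l) o i s t s+i≤t+o (o≤i , _) (bal , med) (inj₁ cut ∷ kinds) =
      +-mono-≤ (+-cancelʳ-≤ o s t (≤-trans (+-monoʳ-≤ s o≤i) s+i≤t+o))
       (≤-trans (≤-reflexive (cong (_+ total α l) (α-cut cut)))
         -- The cut `u` adds nothing to the sum of `α` and becomes the end of a fresh interval.
         (≤-trans (feed (inj₂ cut) l 0 0 0 0 z≤n bal med kinds) (m≤n+m _ (γ u))))
    feed {z} z∈ (u ∷ l) o i s t s+i≤t+o (o≤i , bal) (_ , med) (inj₂ fair ∷ kinds) =
      subst₂ _≤_ (+-assoc s (α u) _) (+-assoc t (γ u) _)
        (feed z∈ l (o + e z u) (i + e u z) (s + α u) (t + γ u)
          (subst₂ _≤_ (lemma s i (α u) (e u z)) (lemma t o (γ u) (e z u))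
                      (+-mono-≤ s+i≤t+o (fair z∈)))
          bal med kinds)
      where
      lemma : ∀ a b c d → a + b + (c + d) ≡ a + c + (b + d)
      lemma = solve-∀

-- Forbidden induced subgraphs

symClosure? : ∀ {A : Set} {R : A → A → Set} → Decidable R → Decidable (SymClosure R)
symClosure? R? i j =
  map′ [ fwd , bwd ]′ (λ { (fwd r) → inj₁ r ; (bwd r) → inj₂ r }) (R? i j ⊎-dec R? j i)

cycle? : ∀ n .{{_ : NonZero n}} → Decidable (Adj (cycle n))
cycle? n i j = ¬? (i ≟ j) ×-dec symClosure? (λ i j → toℕ j ℕ.≟ suc (toℕ i) % n) i j

complement? : ∀ {n} {H : Graph (Fin n)} → Decidable (Adj H) → Decidable (Adj (complement H))
complement? adj? i j = ¬? (i ≟ j) ×-dec ¬? (adj? i j)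

chairEdge? : Decidable ChairEdge
chairEdge? 0F 0F                  = no λ ()
chairEdge? 0F 1F                  = yes xy
chairEdge? 0F (suc (suc _))       = no λ ()
chairEdge? 1F 0F                  = no λ ()
chairEdge? 1F 1F                  = no λ ()
chairEdge? 1F 2F                  = yes yz
chairEdge? 1F (suc (suc (suc _))) = no λ ()
chairEdge? 2F 0F                  = no λ ()
chairEdge? 2F 1F                  = no λ ()
chairEdge? 2F 2F                  = no λ ()
chairEdge? 2F 3F                  = yes zt
chairEdge? 2F 4F                  = yes zv
chairEdge? 3F _                   = no λ ()
chairEdge? 4F _                   = no λ ()

-- Nested products let the adjacencies of a pattern be written out as tuples, one row per vertex.
Each : ∀ {k} → (Fin k → Set) → Set
Each {zero}  P = ⊤
Each {suc k} P = P zero × Each (P ∘ suc)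

each : ∀ {k} {P : Fin k → Set} → Each P → ∀ i → P i
each (p , ps) zero    = p
each (p , ps) (suc i) = each ps i

Increasing : ∀ {k} → (Fin k → Fin k → Set) → Set
Increasing {zero}  R = ⊤
Increasing {suc k} R = Each (R zero ∘ suc) × Increasing (λ i j → R (suc i) (suc j))

increasing : ∀ {k} {R : Fin k → Fin k → Set} → Increasing R → ∀ {i j} → i <ᶠ j → R i j
increasing (rs , _) {zero}  {suc j} _   = each rs j
increasing (_ , rs) {suc i} {suc j} i<j = increasing rs (s<s⁻¹ i<j)

module MissingGraph {n} (S : Subset n) (G : Graph (∃ (_∈ S))) (D : Digraph n)
                    (missing : IsMissing D S G) where

  infix 4 _~_
  _~_ : Fin n → Fin n → Set
  _~_ = MissingEdge D

  ~-sym : ∀ {u v} → u ~ v → v ~ u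
  ~-sym (u≢v , ¬uv , ¬vu) = ≢-sym u≢v , ¬vu , ¬uv

  ~⇒∈ : ∀ {u v} → u ~ v → u ∈ S
  ~⇒∈ u~v = proj₁ (Equivalence.to (missing _ _) u~v)

  ~⇒Adj : ∀ {u v} (p : u ∈ S) (q : v ∈ S) → u ~ v → Adj G (u , p) (v , q)
  ~⇒Adj p q u~v with p′ , q′ , uv ← Equivalence.to (missing _ _) u~v =
    subst₂ (λ p q → Adj G (_ , p) (_ , q)) ([]=-irrelevant p′ p) ([]=-irrelevant q′ q) uv

  Adj⇒~ : ∀ {u v} {p : u ∈ S} {q : v ∈ S} → Adj G (u , p) (v , q) → u ~ v
  Adj⇒~ uv = Equivalence.from (missing _ _) (_ , _ , uv)

  -- A missing edge has distinct ends already; a non-edge must ask for this, so that a pattern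
  -- yields an injective map.
  Pattern : ∀ {P : Set} → Dec P → Fin n → Fin n → Set
  Pattern d u v = if does d then u ~ v else u ≢ v × ¬ u ~ v

  -- The implicit argument, checked by evaluation, says that `H` has no isolated vertex; this puts
  -- every listed vertex into `S`.
  copy : ∀ {k} {H : Graph (Fin k)} (adj? : Decidable (Adj H))
         {_ : True (all? λ i → any? (adj? i))} (vs : Vec (Fin n) k) →
         Increasing (λ i j → Pattern (adj? i j) (Vec.lookup vs i) (Vec.lookup vs j)) →
         InducedCopy H G
  copy {k} {H} adj? {partner} vs pattern′ = record
    { f         = λ i → g i , g∈S i
    ; injective = injective
    ; adj       = λ i j → mk⇔ (⇒ i j) (⇐ i j)
    }
    where
    g : Fin k → Fin n
    g = Vec.lookup vs

    Faithful : Fin k → Fin k → Set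
    Faithful i j = (Adj H i j → g i ~ g j) × (g i ~ g j → Adj H i j) × g i ≢ g j

    faithful-< : ∀ {i j} → i <ᶠ j → Faithful i j
    faithful-< {i} {j} i<j with adj? i j | increasing pattern′ i<j
    ... | yes ij | i~j         = (λ _ → i~j) , (λ _ → ij) , proj₁ i~j
    ... | no ¬ij | gi≢gj , i≁j = flip contradiction ¬ij , flip contradiction i≁j , gi≢gj

    faithful : ∀ {i j} → i ≢ j → Faithful i j
    faithful {i} {j} i≢j with <-cmp i j
    ... | tri< i<j _ _ = faithful-< i<j
    ... | tri≈ _ i≡j _ = contradiction i≡j i≢j
    ... | tri> _ _ j<i with to , from , gj≢gi ← faithful-< j<i =
      ~-sym ∘ to ∘ Graph.sym H , Graph.sym H ∘ from ∘ ~-sym , ≢-sym gj≢gi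

    Adj⇒≢ : ∀ {i j} → Adj H i j → i ≢ j
    Adj⇒≢ ij i≡j = irrefl H i≡j ij

    g∈S : ∀ i → g i ∈ S
    g∈S i with j , ij ← toWitness partner i = ~⇒∈ (proj₁ (faithful (Adj⇒≢ ij)) ij)

    injective : Injective _≡_ _≡_ λ i → g i , g∈S i
    injective {i} {j} fi≡fj with i ≟ j
    ... | yes i≡j = i≡j
    ... | no  i≢j = contradiction (cong proj₁ fi≡fj) (proj₂ (proj₂ (faithful i≢j)))

    ⇒ : ∀ i j → Adj H i j → Adj G (g i , g∈S i) (g j , g∈S j)
    ⇒ i j ij = ~⇒Adj _ _ (proj₁ (faithful (Adj⇒≢ ij)) ij)

    ⇐ : ∀ i j → Adj G (g i , g∈S i) (g j , g∈S j) → Adj H i j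
    ⇐ i j gij with i ≟ j
    ... | yes refl = contradiction gij (irrefl G refl)
    ... | no  i≢j  = proj₁ (proj₂ (faithful i≢j)) (Adj⇒~ gij)

module CombMissing {n} (S : Subset n) (G : Graph (∃ (_∈ S))) (comb : IsComb G) (D : Digraph n)
                   (oriented : IsOriented D) (missing : IsMissing D S G) where

  open IsComb comb
  open Digraph D
  open IsOriented oriented
  open MissingGraph S G D missing

  _~?_ : Decidable _~_
  u ~? v = ¬? (u ≟ v) ×-dec ¬? (arc? u v) ×-dec ¬? (arc? v u)

  ≁⇒≢ : ∀ {u v w} → u ~ v → ¬ w ~ v → u ≢ w
  ≁⇒≢ u~v w≁v refl = w≁v u~v

  record Path₄ (a b c d : Fin n) : Set where
    field
      ab : a ~ b
      bc : b ~ c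
      cd : c ~ d
      ¬ac : ¬ a ~ c
      ¬ad : ¬ a ~ d
      ¬bd : ¬ b ~ d

    a≢c : a ≢ c
    a≢c = ≢-sym (≁⇒≢ cd ¬ad)

    a≢d : a ≢ d
    a≢d = ≢-sym (≁⇒≢ (~-sym cd) ¬ac)

    b≢d : b ≢ d
    b≢d = ≁⇒≢ (~-sym ab) (¬ad ∘ ~-sym)

  no-C₄ : ∀ {a b c d} → a ~ b → b ~ c → c ~ d → d ~ a → a ≢ c → b ≢ d → ¬ a ~ c → ¬ b ~ d → ⊥
  no-C₄ {a} {b} {c} {d} ab bc cd da a≢c b≢d ¬ac ¬bd =
    C₄-free (copy (cycle? 4) (a ∷ b ∷ c ∷ d ∷ [])
      ((ab , (a≢c , ¬ac) , ~-sym da , tt) , (bc , (b≢d , ¬bd) , tt) , (cd , tt) , tt , tt))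

  -- The complement of a four-cycle consists of its diagonals; here the cycle is `a c b d`.
  no-2K₂ : ∀ {a b c d} → a ~ b → c ~ d → ¬ a ~ c → ¬ a ~ d → ¬ b ~ c → ¬ b ~ d → ⊥
  no-2K₂ {a} {b} {c} {d} ab cd ¬ac ¬ad ¬bc ¬bd =
    co-C₄-free (copy (complement? {H = cycle 4} (cycle? 4)) (a ∷ c ∷ b ∷ d ∷ [])
      (((≢-sym (≁⇒≢ cd ¬ad) , ¬ac) , ab , (≢-sym (≁⇒≢ (~-sym cd) ¬ac) , ¬ad) , tt)
      , ((≁⇒≢ cd ¬bd , ¬bc ∘ ~-sym) , cd , tt)
      , ((≢-sym (≁⇒≢ (~-sym cd) ¬bc) , ¬bd) , tt) , tt , tt))

  no-C₅ : ∀ {a b c d e} → Path₄ a b c d → a ~ e → d ~ e → ¬ b ~ e → ¬ c ~ e → ⊥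
  no-C₅ {a} {b} {c} {d} {e} p ae de ¬be ¬ce =
    C₅-free (copy (cycle? 5) (a ∷ b ∷ c ∷ d ∷ e ∷ [])
      ((ab , (a≢c , ¬ac) , (a≢d , ¬ad) , ae , tt)
      , (bc , (b≢d , ¬bd) , (≁⇒≢ bc (¬ce ∘ ~-sym) , ¬be) , tt)
      , (cd , (≁⇒≢ (~-sym bc) (¬be ∘ ~-sym) , ¬ce) , tt)
      , (de , tt) , tt , tt))
    where open Path₄ p

  no-chair : ∀ {a b c d e} → Path₄ a b c d → b ~ e → a ≢ e → ¬ a ~ e → ¬ c ~ e → ¬ d ~ e → ⊥
  no-chair {a} {b} {c} {d} {e} p be a≢e ¬ae ¬ce ¬de =
    chair-free (copy {H = chair} (symClosure? chairEdge?) (d ∷ c ∷ b ∷ a ∷ e ∷ [])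
      ((~-sym cd , (≢-sym b≢d , ¬bd ∘ ~-sym) , (≢-sym a≢d , ¬ad ∘ ~-sym)
         , (≁⇒≢ (~-sym cd) (¬ce ∘ ~-sym) , ¬de) , tt)
      , (~-sym bc , (≢-sym a≢c , ¬ac ∘ ~-sym) , (≁⇒≢ cd (¬de ∘ ~-sym) , ¬ce) , tt)
      , (~-sym ab , be , tt) , ((a≢e , ¬ae) , tt) , tt , tt))
    where open Path₄ p

  -- In the complement, `c a d b` is a path and `e` hangs on `d`, which is a chair.
  no-co-chair : ∀ {a b c d e} → Path₄ a b c d → a ~ e → b ~ e → c ~ e → d ≢ e → ¬ d ~ e → ⊥
  no-co-chair {a} {b} {c} {d} {e} p ae be ce d≢e ¬de =
    co-chair-free (copy (complement? {H = chair} (symClosure? chairEdge?)) (c ∷ a ∷ d ∷ b ∷ e ∷ [])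
      (((≢-sym a≢c , ¬ac ∘ ~-sym) , cd , ~-sym bc , ce , tt)
      , ((a≢d , ¬ad) , ab , ae , tt)
      , ((≢-sym b≢d , ¬bd ∘ ~-sym) , (d≢e , ¬de) , tt)
      , (be , tt) , tt , tt))
    where open Path₄ p

  reverse : ∀ {a b c d} → Path₄ a b c d → Path₄ d c b a
  reverse p = record
    { ab = ~-sym cd ; bc = ~-sym bc ; cd = ~-sym ab
    ; ¬ac = ¬bd ∘ ~-sym ; ¬ad = ¬ad ∘ ~-sym ; ¬bd = ¬ac ∘ ~-sym }
    where open Path₄ p

  -- Twins around an induced path on four vertices

  module _ {a b c d z : Fin n} (p : Path₄ a b c d) where
    open Path₄ p

    -- Without `zc`, an edge `zd` closes a four-cycle, an edge `za` without `zd` is independent of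
    -- `cd`, and otherwise there is a chair.
    inner-twins : z ~ b → z ≢ a → z ≢ c → z ~ c
    inner-twins zb z≢a z≢c with z ~? c | z ~? d | z ~? a
    ... | yes zc | _      | _      = zc
    ... | no ¬zc | yes zd | _      = ⊥-elim (no-C₄ zb bc cd (~-sym zd) z≢c b≢d ¬zc ¬bd)
    ... | no ¬zc | no ¬zd | yes za = ⊥-elim (no-2K₂ za cd ¬zc ¬zd ¬ac ¬ad)
    ... | no ¬zc | no ¬zd | no ¬za =
      ⊥-elim (no-chair p (~-sym zb) (≢-sym z≢a) (¬za ∘ ~-sym) (¬zc ∘ ~-sym) (¬zd ∘ ~-sym))

    -- Without `zd`, the absence of `zc` leaves `za` and `cd` independent, `zc` without `zb` closes
    -- a four-cycle, and `zc` with `zb` gives a co-chair.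
    outer-twins : z ~ a → z ≢ b → z ~ d
    outer-twins za z≢b with z ~? d | z ~? c | z ~? b
    ... | yes zd | _      | _      = zd
    ... | no ¬zd | no ¬zc | _      = ⊥-elim (no-2K₂ za cd ¬zc ¬zd ¬ac ¬ad)
    ... | no ¬zd | yes zc | no ¬zb = ⊥-elim (no-C₄ za ab bc (~-sym zc) z≢b a≢c ¬zb ¬ac)
    ... | no ¬zd | yes zc | yes zb =
      ⊥-elim (no-co-chair p (~-sym za) (~-sym zb) (~-sym zc)
                          (≢-sym (≁⇒≢ za (¬ad ∘ ~-sym))) (¬zd ∘ ~-sym))

    -- Without `zb`, an edge `zc` closes a four-cycle; otherwise `z` is adjacent to `d` and closes a
    -- five-cycle.
    end-neighbour : z ~ a → z ≢ b → z ~ b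
    end-neighbour za z≢b with z ~? b | z ~? c
    ... | yes zb | _      = zb
    ... | no ¬zb | yes zc = ⊥-elim (no-C₄ za ab bc (~-sym zc) z≢b a≢c ¬zb ¬ac)
    ... | no ¬zb | no ¬zc =
      ⊥-elim (no-C₅ p (~-sym za) (~-sym (outer-twins za z≢b)) (¬zb ∘ ~-sym) (¬zc ∘ ~-sym))

  End : Fin n → Set
  End a = ∃ λ b → ∃ λ c → ∃ λ d → Path₄ a b c d

  -- If `b` ended a path `b q v u`, its nonadjacent neighbours `a` and `c` would both be adjacent to
  -- `q` and `u`, so `a q c u` would be an induced four-cycle.
  inner⇒¬end : ∀ {a b c d} → Path₄ a b c d → ¬ End b
  inner⇒¬end {a} {c = c} p (q , v , u , p′) =
    no-C₄ (end-neighbour p′ ab a≢q) (~-sym (end-neighbour p′ (~-sym bc) c≢q))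
          (outer-twins p′ (~-sym bc) c≢q) (~-sym (outer-twins p′ ab a≢q))
          a≢c (Path₄.b≢d p′) ¬ac (Path₄.¬bd p′)
    where
    open Path₄ p

    a≢q : a ≢ q
    a≢q refl = ¬ac (~-sym (end-neighbour p′ (~-sym bc) (≢-sym a≢c)))

    c≢q : c ≢ q
    c≢q refl = ¬ac (end-neighbour p′ ab a≢c)

  -- Missing edges losing to each other

  infix 4 _⟶_
  _⟶_ : Fin n → Fin n → Set
  _⟶_ = Arc

  ⟶⇒≢ : ∀ {u v} → u ⟶ v → u ≢ v
  ⟶⇒≢ u⟶v refl = loopless refl u⟶v

  ⟶⇒≁ : ∀ {u v} → u ⟶ v → ¬ u ~ v
  ⟶⇒≁ u⟶v (_ , ¬uv , _) = ¬uv u⟶v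

  ⟵⇒≁ : ∀ {u v} → v ⟶ u → ¬ u ~ v
  ⟵⇒≁ v⟶u (_ , _ , ¬vu) = ¬vu v⟶u

  data Compare (u v : Fin n) : Set where
    equal    : u ≡ v → Compare u v
    forward  : u ⟶ v → Compare u v
    backward : v ⟶ u → Compare u v
    absent   : u ~ v → Compare u v

  compare : ∀ u v → Compare u v
  compare u v with u ≟ v | arc? u v | arc? v u
  ... | yes u≡v | _      | _      = equal u≡v
  ... | no u≢v  | yes uv | _      = forward uv
  ... | no u≢v  | no ¬uv | yes vu = backward vu
  ... | no u≢v  | no ¬uv | no ¬vu = absent (u≢v , ¬uv , ¬vu)

  -- v ∈ N⁺ u ∪ N⁺⁺ u
  Reach : Fin n → Fin n → Set
  Reach u v = u ⟶ v ⊎ ∃ λ w → u ⟶ w × w ⟶ v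

  reach? : Decidable Reach
  reach? u v = arc? u v ⊎-dec any? λ w → arc? u w ×-dec arc? w v

  via : ∀ {u v w} → u ⟶ w → w ⟶ v → Reach u v
  via uw wv = inj₂ (_ , uw , wv)

  -- The arcs of the dependency digraph on missing edges, with ordered ends: `x` is matched with `a`
  -- and `y` with `b`.
  record Loses (x y a b : Fin n) : Set where
    constructor loses
    field
      x~y : x ~ y
      a~b : a ~ b
      x⟶a : x ⟶ a
      y⟶b : y ⟶ b
      x⇏b : ¬ Reach x b
      y⇏a : ¬ Reach y a

  loses? : ∀ x y a b → Dec (Loses x y a b)
  loses? x y a b = map′ (λ (p , q , r , s , t , u) → loses p q r s t u)
    (λ (loses p q r s t u) → p , q , r , s , t , u)
    (x ~? y ×-dec a ~? b ×-dec arc? x a ×-dec arc? y b ×-dec ¬? (reach? x b) ×-dec ¬? (reach? y a))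

  flip-loses : ∀ {x y a b} → Loses x y a b → Loses y x b a
  flip-loses (loses p q r s t u) = loses (~-sym p) (~-sym q) s r u t

  Convenient : Fin n → Fin n → Set
  Convenient u v = ∀ z → z ⟶ u → Reach z v

  Obstruction : Fin n → Fin n → Set
  Obstruction u v = ∃ λ z → z ⟶ u × ¬ Reach z v

  obstruction? : Decidable Obstruction
  obstruction? u v = any? λ z → arc? z u ×-dec ¬? (reach? z v)

  convenient⊎obstruction : ∀ u v → Convenient u v ⊎ Obstruction u v
  convenient⊎obstruction u v with obstruction? u v
  ... | yes o = inj₂ o
  ... | no ¬o = inj₁ λ z zu → decidable-stable (reach? z v) λ ¬zv → ¬o (z , zu , ¬zv)

  -- An arc between `x` and `y` would create one of the excluded routes `x ⟶ y ⟶ v` and `y ⟶ x ⟶ u`.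
  obstructed : ∀ {u v x y} → u ~ v → x ⟶ u → ¬ Reach x v → y ⟶ v → ¬ Reach y u → Loses x y u v
  obstructed {u} {v} {x} {y} uv xu ¬xv yv ¬yu with compare x y
  ... | equal refl  = ⊥-elim (¬xv (inj₁ yv))
  ... | forward x⟶y = ⊥-elim (¬xv (via x⟶y yv))
  ... | backward y⟶x = ⊥-elim (¬yu (via y⟶x xu))
  ... | absent x~y  = loses x~y uv xu yv ¬xv ¬yu

  module _ {x y a b : Fin n} (ℓ : Loses x y a b) where
    open Loses ℓ

    -- `y ⟶ a` and `x ⟶ b` are excluded. Two backward arcs would leave two independent edges, and
    -- two missing edges would give a four-cycle.
    path-type : (y ~ a × b ⟶ x) ⊎ (x ~ b × a ⟶ y)
    path-type with compare y a | compare x b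
    ... | equal refl | _ = ⊥-elim (⟶⇒≁ x⟶a x~y)
    ... | forward ya | _ = ⊥-elim (y⇏a (inj₁ ya))
    ... | _ | equal refl = ⊥-elim (⟶⇒≁ x⟶a (~-sym a~b))
    ... | _ | forward xb = ⊥-elim (x⇏b (inj₁ xb))
    ... | backward ay | backward bx =
      ⊥-elim (no-2K₂ x~y a~b (⟶⇒≁ x⟶a) (⟵⇒≁ bx) (⟵⇒≁ ay) (⟶⇒≁ y⟶b))
    ... | absent y~a | absent x~b =
      ⊥-elim (no-C₄ x~y y~a a~b (~-sym x~b) (⟶⇒≢ x⟶a) (⟶⇒≢ y⟶b) (⟶⇒≁ x⟶a) (⟶⇒≁ y⟶b))
    ... | absent y~a | backward bx = inj₁ (y~a , bx)
    ... | backward ay | absent x~b = inj₂ (x~b , ay)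

    path : y ~ a → b ⟶ x → Path₄ x y a b
    path y~a bx = record
      { ab = x~y ; bc = y~a ; cd = a~b ; ¬ac = ⟶⇒≁ x⟶a ; ¬ad = ⟵⇒≁ bx ; ¬bd = ⟶⇒≁ y⟶b }

    flipped-path : x ~ b → a ⟶ y → Path₄ y x b a
    flipped-path x~b ay = record
      { ab = ~-sym x~y ; bc = x~b ; cd = ~-sym a~b
      ; ¬ac = ⟶⇒≁ y⟶b ; ¬ad = ⟵⇒≁ ay ; ¬bd = ⟶⇒≁ x⟶a }

    -- `y` and `a` are the inner vertices of the path `x y a b` or the ends of `y x b a`.
    twins-y : ∀ {z} → z ~ y → z ≢ x → z ≢ a → z ~ a
    twins-y zy z≢x z≢a with path-type
    ... | inj₁ (y~a , bx) = inner-twins (path y~a bx) zy z≢x z≢a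
    ... | inj₂ (x~b , ay) = outer-twins (flipped-path x~b ay) zy z≢x

    twins-a : ∀ {z} → z ~ a → z ≢ b → z ≢ y → z ~ y
    twins-a za z≢b z≢y with path-type
    ... | inj₁ (y~a , bx) = inner-twins (reverse (path y~a bx)) za z≢b z≢y
    ... | inj₂ (x~b , ay) = outer-twins (reverse (flipped-path x~b ay)) za z≢b

    -- If `h ≢ x`, a missing edge `hy` would make `ha` missing, and an arc gives `h ⟶ y ⟶ b` or
    -- `y ⟶ h ⟶ a`. So `x` alone obstructs the direction from `a` to `b`.
    forced : ∀ {h} → h ⟶ a → ¬ Reach h b → h ≡ x
    forced {h} ha ¬hb with compare h y
    ... | equal refl   = ⊥-elim (¬hb (inj₁ y⟶b))
    ... | forward h⟶y  = ⊥-elim (¬hb (via h⟶y y⟶b))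
    ... | backward y⟶h = ⊥-elim (y⇏a (via y⟶h ha))
    ... | absent h~y with h ≟ x
    ...   | yes h≡x = h≡x
    ...   | no  h≢x = ⊥-elim (⟶⇒≁ ha (twins-y h~y h≢x (⟶⇒≢ ha)))

    -- The middle vertex is `a` if `a ⟶ y`. Otherwise it is the obstructing `k`: as `x` is an end of
    -- the path `x y a b`, a missing edge `xk` would make `ky` missing.
    unforced⇒via : Obstruction y x → ∃ λ k → x ⟶ k × k ⟶ y
    unforced⇒via (k , ky , ¬kx) with path-type
    ... | inj₂ (_ , ay) = a , x⟶a , ay
    ... | inj₁ (y~a , bx) with compare x k
    ...   | equal refl   = ⊥-elim (⟶⇒≁ ky x~y)
    ...   | forward x⟶k  = k , x⟶k , ky
    ...   | backward k⟶x = ⊥-elim (¬kx (inj₁ k⟶x))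
    ...   | absent x~k   =
      ⊥-elim (⟶⇒≁ ky (end-neighbour (path y~a bx) (~-sym x~k) (⟶⇒≢ ky)))

  module _ {x y a b : Fin n} (ℓ : Loses x y a b) where
    twins-x : ∀ {z} → z ~ x → z ≢ y → z ≢ b → z ~ b
    twins-x = twins-y (flip-loses ℓ)

    twins-b : ∀ {z} → z ~ b → z ≢ a → z ≢ x → z ~ x
    twins-b = twins-a (flip-loses ℓ)

  -- An arc between `b′` and `a` gives an excluded two-step route; if `b′a` is missing, the twins
  -- `a` and `y` contradict `y ⟶ b′`.
  loses-injective : ∀ {x y a b a′ b′} → Loses x y a b → Loses x y a′ b′ → b ≡ b′
  loses-injective {x} {y} {a} {b} {a′} {b′} ℓ ℓ′ with b ≟ b′
  ... | yes b≡b′ = b≡b′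
  ... | no  b≢b′ with compare b′ a
  ...   | equal refl    = ⊥-elim (Loses.x⇏b ℓ′ (inj₁ (Loses.x⟶a ℓ)))
  ...   | forward b′⟶a  = ⊥-elim (Loses.y⇏a ℓ (via (Loses.y⟶b ℓ′) b′⟶a))
  ...   | backward a⟶b′ = ⊥-elim (Loses.x⇏b ℓ′ (via (Loses.x⟶a ℓ) a⟶b′))
  ...   | absent b′~a   = ⊥-elim (⟵⇒≁ (Loses.y⟶b ℓ′)
    (twins-a ℓ b′~a (≢-sym b≢b′) (≢-sym (⟶⇒≢ (Loses.y⟶b ℓ′)))))

  -- Acyclicity of the losing relation

  Pair : Set
  Pair = Fin n × Fin n

  infix 4 _≺_
  _≺_ : Pair → Pair → Set
  (x , y) ≺ (a , b) = Loses x y a b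

  BackTo : Fin n → Fin n → Set
  BackTo u t = t ⟶ u × End t

  -- The two edges of a step are the end edges of a path x y a b or y x b a.  An arc
  -- leads from the last edge of a chain back to the outer vertex of its first edge,
  -- so that chains of steps cannot be closed.
  Returns : Pair → Pair → Set
  Returns (x , y) (c , d) =
    (∃₂ λ a b → Loses x y a b × y ~ a × b ⟶ x × (BackTo x c ⊎ BackTo x d)) ⊎
    (∃₂ λ a b → Loses x y a b × x ~ b × a ⟶ y × (BackTo y c ⊎ BackTo y d))

  flip-returns : ∀ {x y c d} → Returns (x , y) (c , d) → Returns (y , x) (d , c)
  flip-returns (inj₁ (a , b , ℓ , ya , bx , r)) = inj₂ (b , a , flip-loses ℓ , ya , bx , swap r)
  flip-returns (inj₂ (a , b , ℓ , xb , ay , r)) = inj₁ (b , a , flip-loses ℓ , xb , ay , swap r)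

  ≺⇒returns : ∀ {e e′} → e ≺ e′ → Returns e e′
  ≺⇒returns ℓ with path-type ℓ
  ... | inj₁ (y~a , bx) =
    inj₁ (_ , _ , ℓ , y~a , bx , inj₂ (bx , _ , _ , _ , reverse (path ℓ y~a bx)))
  ... | inj₂ (x~b , ay) =
    inj₂ (_ , _ , ℓ , x~b , ay , inj₁ (ay , _ , _ , _ , reverse (flipped-path ℓ x~b ay)))

  module _ {x y a b : Fin n} (ℓ : Loses x y a b) (y~a : y ~ a) (b⟶x : b ⟶ x) where
    open Loses ℓ

    -- `x ⟶ t` would let `x` reach `b`, and a missing edge `tx` would make `tb` missing unless `t`
    -- is `y`, which is inner and so not an end.
    extend : ∀ {t} → BackTo b t → BackTo x t
    extend {t} (tb , end) with compare t x
    ... | equal refl   = ⊥-elim (x⇏b (inj₁ tb))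
    ... | forward t⟶x  = t⟶x , end
    ... | backward x⟶t = ⊥-elim (x⇏b (via x⟶t tb))
    ... | absent t~x with t ≟ y
    ...   | yes refl = ⊥-elim (inner⇒¬end (path ℓ y~a b⟶x) end)
    ...   | no t≢y   = ⊥-elim (⟶⇒≁ tb (twins-x ℓ t~x t≢y (⟶⇒≢ tb)))

    returns-∷ : ∀ {e} → Returns (a , b) e → Returns (x , y) e
    -- Path types alternate: `b` is an end of `x y a b`, so `b ~ c` would force `c ~ a`, against
    -- `a ⟶ c`.
    returns-∷ (inj₁ (_ , _ , ℓ′ , b~c , _)) =
      ⊥-elim (⟶⇒≁ (Loses.x⟶a ℓ′) (~-sym (end-neighbour (reverse (path ℓ y~a b⟶x))
        (~-sym b~c) (≢-sym (⟶⇒≢ (Loses.x⟶a ℓ′))))))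
    returns-∷ (inj₂ (_ , _ , _ , _ , _ , inj₁ c⟶b)) =
      inj₁ (a , b , ℓ , y~a , b⟶x , inj₁ (extend c⟶b))
    returns-∷ (inj₂ (_ , _ , _ , _ , _ , inj₂ d⟶b)) =
      inj₁ (a , b , ℓ , y~a , b⟶x , inj₂ (extend d⟶b))

  chain-returns : ∀ {e e′} → TransClosure _≺_ e e′ → Returns e e′
  chain-returns [ ℓ ] = ≺⇒returns ℓ
  chain-returns (ℓ ∷ ℓs) with path-type ℓ
  ... | inj₁ (y~a , bx) = returns-∷ ℓ y~a bx (chain-returns ℓs)
  ... | inj₂ (x~b , ay) =
    flip-returns (returns-∷ (flip-loses ℓ) x~b ay (flip-returns (chain-returns ℓs)))

  -- On a closed chain the returning arc would be a loop or lie along the missing edge.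
  ≺⁺-irrefl : ∀ {e} → ¬ TransClosure _≺_ e e
  ≺⁺-irrefl es with chain-returns es
  ... | inj₁ (_ , _ , ℓ , _ , _ , inj₁ (r , _)) = loopless refl r
  ... | inj₁ (_ , _ , ℓ , _ , _ , inj₂ (r , _)) = ⟵⇒≁ r (Loses.x~y ℓ)
  ... | inj₂ (_ , _ , ℓ , _ , _ , inj₁ (r , _)) = ⟶⇒≁ r (Loses.x~y ℓ)
  ... | inj₂ (_ , _ , ℓ , _ , _ , inj₂ (r , _)) = loopless refl r

  -- The transitive closure is a strict partial order on a finite set; pairs are coded in
  -- `Fin (n * n)`.
  ≺-wellFounded : WellFounded _≺_
  ≺-wellFounded = wellFounded⁻ _≺_ λ (x , y) →
    transfer (wf (combine x y)) (remQuot-combine x y)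
    where
    _⊏_ : Fin (n * n) → Fin (n * n) → Set
    i ⊏ j = TransClosure _≺_ (remQuot n i) (remQuot n j)

    wf : WellFounded _⊏_
    wf = spo-wellFounded record
      { isEquivalence = ≡.isEquivalence
      ; irrefl        = λ { refl → ≺⁺-irrefl }
      ; trans         = Transitive._++_
      ; <-resp-≈      = (λ { refl r → r }) , (λ { refl r → r })
      }

    transfer : ∀ {i e} → Acc _⊏_ i → remQuot n i ≡ e → Acc (TransClosure _≺_) e
    transfer {i} (acc rs) refl = acc λ { {x , y} r →
      transfer (rs {combine x y} (subst (λ e → TransClosure _≺_ e (remQuot n i))
                 (≡.sym (remQuot-combine x y)) r))
               (remQuot-combine x y) }

  -- The last condition on a step implies y ∈ N⁺⁺ x.  If x y a b is a path, it says that
  -- xy passes its direction on only when the direction yx is not convenient.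
  data Allowed : Fin n → Fin n → Set where
    convenient : ∀ {a b} → Convenient a b → Allowed a b
    step : ∀ {x y a b} → Loses x y a b → Allowed x y → a ⟶ y ⊎ Obstruction y x → Allowed a b

  -- Decidability and totality of allowed directions

  Step : Fin n → Fin n → Fin n → Fin n → Set
  Step x y a b = Loses x y a b × Allowed x y × (a ⟶ y ⊎ Obstruction y x)

  convenient? : Decidable Convenient
  convenient? u v with convenient⊎obstruction u v
  ... | inj₁ c = yes c
  ... | inj₂ (z , zu , ¬zv) = no λ c → ¬zv (c z zu)

  private
    allowed-acc? : ∀ {a b} → Acc _≺_ (a , b) → Dec (Allowed a b)
    allowed-acc? {a} {b} (acc rs) with convenient? a b
    ... | yes c = yes (convenient c)
    ... | no ¬c = map′ (λ { (x , y , ℓ , al , s) → step ℓ al s })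
                       (λ { (convenient c) → contradiction c ¬c
                          ; (step ℓ al s)  → _ , _ , ℓ , al , s })
                       (any? λ x → any? λ y → step-acc? x y)
      where
      step-acc? : ∀ x y → Dec (Step x y a b)
      step-acc? x y with loses? x y a b
      ... | no ¬ℓ = no (¬ℓ ∘ proj₁)
      ... | yes ℓ = map′ (ℓ ,_) proj₂
        (allowed-acc? (rs ℓ) ×-dec (arc? a y ⊎-dec obstruction? y x))

  allowed? : Decidable Allowed
  allowed? a b = allowed-acc? (≺-wellFounded (a , b))

  step? : ∀ x y a b → Dec (Step x y a b)
  step? x y a b = loses? x y a b ×-dec allowed? x y ×-dec (arc? a y ⊎-dec obstruction? y x)

  private
    -- The direction from `x` to `y` passes on freely as `a ⟶ y`. The opposite one needs an
    -- obstruction; if there is none, `x` to `y` is convenient and is used instead.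
    propagate : ∀ {x y a b} → Loses x y a b → a ⟶ y → Allowed x y ⊎ Allowed y x →
                Allowed a b ⊎ Allowed b a
    propagate ℓ ay (inj₁ al) = inj₁ (step ℓ al (inj₁ ay))
    propagate {x} {y} ℓ ay (inj₂ al) with convenient⊎obstruction x y
    ... | inj₁ c = inj₁ (step ℓ (convenient c) (inj₁ ay))
    ... | inj₂ o = inj₂ (step (flip-loses ℓ) al (inj₂ o))

    allowed-total-acc : ∀ {a b} → Acc _≺_ (a , b) → a ~ b → Allowed a b ⊎ Allowed b a
    allowed-total-acc {a} {b} (acc rs) a~b
      with convenient⊎obstruction a b | convenient⊎obstruction b a
    ... | inj₁ c | _ = inj₁ (convenient c)
    ... | inj₂ _ | inj₁ c = inj₂ (convenient c)
    ... | inj₂ (x , xa , ¬xb) | inj₂ (y , yb , ¬ya)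
      with ℓ ← obstructed a~b xa ¬xb yb ¬ya
         | path-type (obstructed a~b xa ¬xb yb ¬ya)
    ... | inj₂ (_ , ay) = propagate ℓ ay (allowed-total-acc (rs ℓ) (Loses.x~y ℓ))
    ... | inj₁ (_ , bx) =
      swap (propagate (flip-loses ℓ) bx (swap (allowed-total-acc (rs ℓ) (Loses.x~y ℓ))))

  allowed-total : ∀ {a b} → a ~ b → Allowed a b ⊎ Allowed b a
  allowed-total = allowed-total-acc (≺-wellFounded _)

  -- Convenience would let `f` reach `v`, and by `forced` an inherited direction can only come from
  -- an edge at `f`.
  allowed-reach : ∀ {f a v} → Allowed a v → f ⟶ a → ¬ Reach f v → ∃ λ y → Step f y a v
  allowed-reach (convenient c) fa ¬fv = ⊥-elim (¬fv (c _ fa))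
  allowed-reach (step ℓ al s) fa ¬fv with refl ← forced ℓ fa ¬fv = _ , ℓ , al , s

  step-via : ∀ {x y a b} → Step x y a b → ∃ λ k → x ⟶ k × k ⟶ y
  step-via (ℓ , _ , inj₁ ay) = _ , Loses.x⟶a ℓ , ay
  step-via (ℓ , _ , inj₂ o)  = unforced⇒via ℓ o

  infix 4 _⇝_
  _⇝_ : Fin n → Fin n → Set
  u ⇝ v = u ⟶ v ⊎ u ~ v × Allowed u v

  _⇝?_ : Decidable _⇝_
  u ⇝? v = arc? u v ⊎-dec (u ~? v ×-dec allowed? u v)

  ⇝-total : ∀ {u v} → u ≢ v → u ⇝ v ⊎ v ⇝ u
  ⇝-total {u} {v} u≢v with compare u v
  ... | equal u≡v    = contradiction u≡v u≢v
  ... | forward u⟶v  = inj₁ (inj₁ u⟶v)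
  ... | backward v⟶u = inj₂ (inj₁ v⟶u)
  ... | absent u~v with allowed-total u~v
  ...   | inj₁ al = inj₁ (inj₂ (u~v , al))
  ...   | inj₂ al = inj₂ (inj₂ (~-sym u~v , al))

  -- Why a cut vertex dominates a paying one

  no-predecessor : ∀ {x y a b h x₀ h₀} → Loses x y a b → b ~ h → h ~ a ⊎ x ~ b →
                   ¬ Loses x₀ h₀ x h
  no-predecessor {x} {y} {a} {b} {h} {x₀} {h₀} ℓ b~h type ℓ₀ with b ≟ x₀ | type
  -- Twins carry `b ~ h` to `b ~ x₀` and then to `x₀ ~ x`, against the arc `x₀ ⟶ x`.
  ... | no b≢x₀ | _ = ⟶⇒≁ x₀⟶x (twins-b ℓ (~-sym b~x₀) x₀≢a (⟶⇒≢ x₀⟶x))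
    where
    open Loses ℓ₀ renaming (x⟶a to x₀⟶x)

    x₀≢a : x₀ ≢ a
    x₀≢a refl = digonless x₀⟶x (Loses.x⟶a ℓ)

    b≢x : b ≢ x
    b≢x refl = ⟵⇒≁ (Loses.y⟶b ℓ) (Loses.x~y ℓ)

    b~x₀ : b ~ x₀
    b~x₀ = twins-b ℓ₀ b~h b≢x b≢x₀
  ... | yes refl | inj₂ x~b = ⟵⇒≁ (Loses.x⟶a ℓ₀) x~b
  ... | yes refl | inj₁ h~a with path-type ℓ₀
  ...   | inj₁ (_ , h⟶b) = ⟶⇒≁ h⟶b (~-sym b~h)
  ...   | inj₂ (_ , x⟶h₀) =
    ⟵⇒≁ x⟶h₀ (twins-b ℓ (~-sym (Loses.x~y ℓ₀)) h₀≢a (≢-sym (⟶⇒≢ x⟶h₀)))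
    where
    h₀≢a : h₀ ≢ a
    h₀≢a refl = ⟵⇒≁ (Loses.y⟶b ℓ₀) h~a

  -- Two losses share `x` and `a`. The goal is `allowed-az`: if `xy` passes a direction on to `ab`,
  -- then `xh` passes one on to `az`.
  module TwoLosses {x y a b h z : Fin n} (ℓ : Loses x y a b) (ℓ′ : Loses x h a z) (z~y : z ~ y)
                   (h⇏y : ¬ Reach h y) where

    open Loses ℓ
    open Loses ℓ′ using () renaming (x~y to x~h; a~b to a~z; y⟶b to h⟶z; x⇏b to x⇏z; y⇏a to h⇏a)

    z≢x : z ≢ x
    z≢x refl = ⟵⇒≁ h⟶z x~h

    z≢a : z ≢ a
    z≢a refl = x⇏z (inj₁ x⟶a)

    z≢y : z ≢ y
    z≢y = proj₁ z~y

    z≢b : z ≢ b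
    z≢b refl = ⟵⇒≁ y⟶b z~y

    b≢x : b ≢ x
    b≢x refl = ⟵⇒≁ y⟶b x~y

    b≢h : b ≢ h
    b≢h refl with path-type ℓ
    ... | inj₁ (_ , b⟶x) = ⟵⇒≁ b⟶x x~h
    ... | inj₂ (x~b , a⟶y) = ⟵⇒≁ h⟶z (twins-x ℓ z~x z≢y z≢b)
      where
      z~x : z ~ x
      z~x = end-neighbour (flipped-path ℓ x~b a⟶y) z~y z≢x

    b~h : b ~ h
    b~h = twins-a ℓ′ (~-sym a~b) (≢-sym z≢b) b≢h

    -- With mixed types, twins give `z ~ b` and then make `bx` or `zx` missing where there is an
    -- arc.
    same-type : (y ~ a × h ~ a) ⊎ (x ~ z × a ⟶ h)
    same-type with path-type ℓ | path-type ℓ′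
    ... | inj₁ (y~a , _) | inj₁ (h~a , _)   = inj₁ (y~a , h~a)
    ... | inj₂ _         | inj₂ (x~z , a⟶h) = inj₂ (x~z , a⟶h)
    ... | inj₁ (_ , b⟶x) | inj₂ (x~z , _)   =
      ⊥-elim (⟶⇒≁ b⟶x (twins-b ℓ′ (~-sym z~b) (≢-sym (proj₁ a~b)) b≢x))
      where
      z~b : z ~ b
      z~b = twins-x ℓ (~-sym x~z) z≢y z≢b
    ... | inj₂ (x~b , _) | inj₁ (_ , z⟶x)   =
      ⊥-elim (⟶⇒≁ z⟶x (twins-b ℓ (~-sym b~z) z≢a z≢x))
      where
      b~z : b ~ z
      b~z = twins-x ℓ′ (~-sym x~b) b≢h (≢-sym z≢b)

    h⟶_⟶y : ∀ k → h ⟶ k → ¬ k ⟶ y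
    h⟶_⟶y k hk ky = h⇏y (via hk ky)

    -- Twins carry the missing edge `kh` to `ka` and then to `ky`.
    h-neighbour : ∀ {k} → k ~ h → k ≢ x → k ≢ a → ¬ k ⟶ y
    h-neighbour k~h k≢x k≢a k⟶y = ⟶⇒≁ k⟶y (twins-a ℓ (twins-y ℓ′ k~h k≢x k≢a) k≢b (⟶⇒≢ k⟶y))
      where
      k≢b : _ ≢ b
      k≢b refl = digonless y⟶b k⟶y

    -- An obstructing `g` has `h ⟶ g`, so convenience must lead it to `y` through some `w`; every
    -- relation between `w` and `h` is then impossible.
    no-obstruction : Allowed x y → x ~ z → a ⟶ h → ¬ Obstruction x h
    no-obstruction (step ℓ₀ _ _) x~z a⟶h _ = no-predecessor ℓ′ z~y (inj₂ x~z) ℓ₀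
    no-obstruction (convenient c) x~z a⟶h (g , gx , g⇏h) with compare h g
    ... | equal refl   = ⟵⇒≁ gx x~h
    ... | backward g⟶h = g⇏h (inj₁ g⟶h)
    ... | absent h~g   =
      ⟶⇒≁ gx (end-neighbour (flipped-path ℓ′ x~z a⟶h) (~-sym h~g) (⟶⇒≢ gx))
    ... | forward h⟶g with c g gx
    ...   | inj₁ g⟶y = h⟶ g ⟶y h⟶g g⟶y
    ...   | inj₂ (w , g⟶w , w⟶y) with compare w h
    ...     | equal refl   = g⇏h (inj₁ g⟶w)
    ...     | forward w⟶h  = g⇏h (via g⟶w w⟶h)
    ...     | backward h⟶w = h⟶ w ⟶y h⟶w w⟶y
    ...     | absent w~h   =
      h-neighbour w~h (λ { refl → ⟶⇒≁ w⟶y x~y }) (λ { refl → ⟶⇒≁ a⟶h w~h }) w⟶y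

    -- If `h` to `x` were convenient, `k ⟶ h` would let `k` reach `x`; `h ⟶ k` would let `h` reach
    -- `y`, and `h-neighbour` excludes a missing edge.
    obstruction-transfer : y ~ a → Obstruction y x → Obstruction h x
    obstruction-transfer y~a (k , k⟶y , k⇏x) with convenient⊎obstruction h x
    ... | inj₂ o = o
    ... | inj₁ c with compare k h
    ...   | equal refl   = ⊥-elim (h⇏y (inj₁ k⟶y))
    ...   | forward k⟶h  = ⊥-elim (k⇏x (c k k⟶h))
    ...   | backward h⟶k = ⊥-elim (h⟶ k ⟶y h⟶k k⟶y)
    ...   | absent k~h   = ⊥-elim
      (h-neighbour k~h (λ { refl → ⟶⇒≁ k⟶y x~y }) (λ { refl → ⟵⇒≁ k⟶y y~a }) k⟶y)

    allowed-xh : h ~ a → Obstruction h x → Allowed x h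
    allowed-xh h~a (k , k⟶h , k⇏x) with allowed-total x~h
    ... | inj₁ al             = al
    ... | inj₂ (convenient c) = contradiction (c k k⟶h) k⇏x
    ... | inj₂ (step ℓ₀ _ _)  = ⊥-elim (no-predecessor ℓ b~h (inj₁ h~a) (flip-loses ℓ₀))

    allowed-az : Step x y a b → Allowed a z
    allowed-az (_ , al , s) with same-type | s
    ... | inj₁ (y~a , _)   | inj₁ a⟶y = ⊥-elim (⟵⇒≁ a⟶y y~a)
    ... | inj₁ (y~a , h~a) | inj₂ o with o′ ← obstruction-transfer y~a o =
      step ℓ′ (allowed-xh h~a o′) (inj₂ o′)
    ... | inj₂ (x~z , a⟶h) | _ with convenient⊎obstruction x h
    ...   | inj₁ c = step ℓ′ (convenient c) (inj₁ a⟶h)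
    ...   | inj₂ o = ⊥-elim (no-obstruction al x~z a⟶h o)

  -- If `zy` is missing and `h` obstructs its direction to `y`, then `xh` loses to `az` as well, and
  -- `TwoLosses` allows `a` to `z`, which is excluded.
  dominates : ∀ {x y a b z} → Step x y a b → z ≢ x → ¬ Reach x z →
              (∀ {c} → x ⟶ c → c ~ z → ¬ Allowed c z) → z ⇝ y
  dominates {x} {y} {a} {b} {z} σ@(ℓ , al , s) z≢x x⇏z ¬al = by-comparison (compare z y)
    where
    open Loses ℓ

    z≢a : z ≢ a
    z≢a refl = x⇏z (inj₁ x⟶a)

    z≢y : z ≢ y
    z≢y refl with k , x⟶k , k⟶y ← step-via σ = x⇏z (via x⟶k k⟶y)

    z≢b : z ≢ b
    z≢b refl = ¬al x⟶a a~b (step ℓ al s)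

    module _ (z~y : z ~ y) {h} (h⟶z : h ⟶ z) (h⇏y : ¬ Reach h y) where
      z~a : z ~ a
      z~a = twins-y ℓ z~y z≢x z≢a

      h≢x : h ≢ x
      h≢x refl = x⇏z (inj₁ h⟶z)

      ¬h⟶a : ¬ h ⟶ a
      ¬h⟶a h⟶a with compare h y
      ... | equal refl   = ⟶⇒≁ h⟶z (~-sym z~y)
      ... | forward h⟶y  = h⇏y (inj₁ h⟶y)
      ... | backward y⟶h = y⇏a (via y⟶h h⟶a)
      ... | absent h~y   = ⟶⇒≁ h⟶a (twins-y ℓ h~y h≢x (⟶⇒≢ h⟶a))

      ¬h⟶x : Allowed x y → ¬ h ⟶ x
      ¬h⟶x (convenient c) h⟶x = h⇏y (c h h⟶x)
      -- Only the first vertex of `ℓ₀` obstructs, so it is `h`, and twins turn `z ~ y` into `z ~ h`.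
      ¬h⟶x (step ℓ₀ _ _)  h⟶x with refl ← forced ℓ₀ h⟶x h⇏y =
        ⟵⇒≁ h⟶z (twins-b ℓ₀ z~y z≢x (≢-sym (⟶⇒≢ h⟶z)))

      h⇏a : ¬ Reach h a
      h⇏a (inj₁ h⟶a) = ¬h⟶a h⟶a
      h⇏a (inj₂ (w , h⟶w , w⟶a)) with compare w y
      ... | equal refl   = h⇏y (inj₁ h⟶w)
      ... | forward w⟶y  = h⇏y (via h⟶w w⟶y)
      ... | backward y⟶w = y⇏a (via y⟶w w⟶a)
      ... | absent w~y with w ≟ x
      ...   | yes refl = ¬h⟶x al h⟶w
      ...   | no  w≢x  = ⟶⇒≁ w⟶a (twins-y ℓ w~y w≢x (⟶⇒≢ w⟶a))

      impossible : ⊥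
      impossible = ¬al x⟶a (~-sym z~a) (TwoLosses.allowed-az ℓ ℓ′ z~y h⇏y σ)
        where
        ℓ′ : Loses x h a z
        ℓ′ = obstructed (~-sym z~a) x⟶a x⇏z h⟶z h⇏a

    by-comparison : Compare z y → z ⇝ y
    by-comparison (equal z≡y)    = contradiction z≡y z≢y
    by-comparison (forward z⟶y)  = inj₁ z⟶y
    by-comparison (backward y⟶z) with compare z a
    ... | equal z≡a    = contradiction z≡a z≢a
    ... | forward z⟶a  = ⊥-elim (y⇏a (via y⟶z z⟶a))
    ... | backward a⟶z = ⊥-elim (x⇏z (via x⟶a a⟶z))
    ... | absent z~a   = ⊥-elim (⟵⇒≁ y⟶z (twins-a ℓ z~a z≢b z≢y))
    by-comparison (absent z~y) with convenient⊎obstruction z y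
    ... | inj₁ c = inj₂ (z~y , convenient c)
    ... | inj₂ (h , h⟶z , h⇏y) = ⊥-elim (impossible z~y h⟶z h⇏y)

  -- The feed vertex

  e : Fin n → Fin n → ℕ
  e u v = indicator (u ⇝? v)

  open MedianOrder e

  module FeedVertex (f : Fin n) where

    Second : Fin n → Set
    Second v = (∃ λ u → f ⟶ u × u ⟶ v) × ¬ f ⟶ v

    second? : U.Decidable Second
    second? v = any? (λ u → arc? f u ×-dec arc? u v) ×-dec ¬? (arc? f v)

    -- The vertices outside N⁺ f ∪ N⁺⁺ f that f reaches in two steps of ⇝.
    Gained : Fin n → Set
    Gained v = v ≢ f × ¬ Reach f v × ∃ λ a → f ⟶ a × a ~ v × Allowed a v

    gained? : U.Decidable Gained
    gained? v = ¬? (v ≟ f) ×-dec ¬? (reach? f v) ×-dec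
                any? λ a → arc? f a ×-dec a ~? v ×-dec allowed? a v

    Pays : Fin n → Fin n → Set
    Pays y v = ∃ λ a → Step f y a v

    Paying : Fin n → Set
    Paying y = ∃ (Pays y)

    paying? : U.Decidable Paying
    paying? y = any? λ v → any? λ a → step? f y a v

    -- No out-neighbour `c` of `f` has `c ⇝ z`, so by totality `z` dominates all of `N⁺ f`.
    Cut : Fin n → Set
    Cut z = z ≢ f × ¬ Reach f z × ∀ {c} → f ⟶ c → c ~ z → ¬ Allowed c z

    paying⇒second : ∀ {y} → Paying y → Second y
    paying⇒second (_ , _ , σ@(ℓ , _)) = step-via σ , λ f⟶y → ⟶⇒≁ f⟶y (Loses.x~y ℓ)

    gained⇒pays : ∀ {v} → Gained v → ∃ λ y → Paying y × Pays y v
    gained⇒pays (_ , f⇏v , a , f⟶a , _ , al) with y , σ ← allowed-reach al f⟶a f⇏v =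
      y , (_ , a , σ) , a , σ

    pays-injective : ∀ {v v′ y} → Pays y v → Pays y v′ → v ≡ v′
    pays-injective (_ , ℓ , _) (_ , ℓ′ , _) = loses-injective ℓ ℓ′

    kept? : U.Decidable λ u → Second u × ¬ Paying u
    kept? u = second? u ×-dec ¬? (paying? u)

    -- Each gained vertex takes the place of a paying vertex dropped from `N⁺⁺ f`.
    α γ : Fin n → ℕ
    α u = indicator (arc? f u)
    γ u = indicator (kept? u) + indicator (gained? u)

    α-cut : ∀ {z} → Cut z → α z ≡ 0
    α-cut (_ , f⇏z , _) = indicator-no (arc? f _) (f⇏z ∘ inj₁)

    open Feed α γ Cut α-cut f

    fair-first : ∀ {u} → f ⟶ u → Fair u
    fair-first {u} f⟶u {z} z∈ = begin
      α u + e u z ≡⟨ cong (α u +_) (indicator-no (u ⇝? z) (¬u⇝z z∈)) ⟩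
      α u + 0     ≡⟨ +-identityʳ (α u) ⟩
      α u         ≤⟨ indicator≤1 (arc? f u) ⟩
      1           ≡⟨ indicator-yes (z ⇝? u) (z⇝u z∈) ⟨
      e z u       ≤⟨ m≤n+m (e z u) (γ u) ⟩
      γ u + e z u ∎
      where
      open ≤-Reasoning

      ¬u⇝z : z ≡ f ⊎ Cut z → ¬ u ⇝ z
      ¬u⇝z (inj₁ refl) (inj₁ u⟶f)       = digonless u⟶f f⟶u
      ¬u⇝z (inj₁ refl) (inj₂ (u~f , _)) = ⟵⇒≁ f⟶u u~f
      ¬u⇝z (inj₂ (_ , f⇏z , _))   (inj₁ u⟶z)        = f⇏z (via f⟶u u⟶z)
      ¬u⇝z (inj₂ (_ , _ , ¬al)) (inj₂ (u~z , al)) = ¬al f⟶u u~z al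

      z⇝u : z ≡ f ⊎ Cut z → z ⇝ u
      z⇝u (inj₁ refl) = inj₁ f⟶u
      z⇝u (inj₂ cut@(_ , f⇏z , _))
        with ⇝-total {u} {z} (λ { refl → f⇏z (inj₁ f⟶u) })
      ... | inj₁ u⇝z = contradiction u⇝z (¬u⇝z (inj₂ cut))
      ... | inj₂ z⇝u = z⇝u

    fair-good : ∀ {u} → ¬ f ⟶ u → 1 ≤ γ u → Fair u
    fair-good {u} ¬f⟶u 1≤γ {z} _ = begin
      α u + e u z ≡⟨ cong (_+ e u z) (indicator-no (arc? f u) ¬f⟶u) ⟩
      e u z       ≤⟨ indicator≤1 (u ⇝? z) ⟩
      1           ≤⟨ 1≤γ ⟩
      γ u         ≤⟨ m≤m+n (γ u) (e z u) ⟩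
      γ u + e z u ∎
      where open ≤-Reasoning

    -- `γ u` may vanish, so `z ⇝ u` has to offset `u ⇝ z`: it is the allowed direction when `z` is
    -- `f`, and comes from `dominates` at a cut.
    fair-paying : ∀ {u} → Paying u → Fair u
    fair-paying {u} (_ , _ , σ@(ℓ , al , _)) {z} z∈ = begin
      α u + e u z ≡⟨ cong (_+ e u z) (indicator-no (arc? f u) λ f⟶u → ⟶⇒≁ f⟶u (Loses.x~y ℓ)) ⟩
      e u z       ≤⟨ indicator≤1 (u ⇝? z) ⟩
      1           ≡⟨ indicator-yes (z ⇝? u) (z⇝u z∈) ⟨
      e z u       ≤⟨ m≤n+m (e z u) (γ u) ⟩
      γ u + e z u ∎
      where
      open ≤-Reasoning

      z⇝u : z ≡ f ⊎ Cut z → z ⇝ u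
      z⇝u (inj₁ refl)              = inj₂ (Loses.x~y ℓ , al)
      z⇝u (inj₂ (z≢f , f⇏z , ¬al)) = dominates σ z≢f f⇏z ¬al

    cut⊎fair : ∀ u → u ≢ f → Cut u ⊎ Fair u
    cut⊎fair u u≢f = classify (arc? f u) (reach? f u) (paying? u) (gained? u)
      where
      classify : Dec (f ⟶ u) → Dec (Reach f u) → Dec (Paying u) → Dec (Gained u) → Cut u ⊎ Fair u
      classify (yes f⟶u) _ _ _ = inj₂ (fair-first f⟶u)
      classify (no ¬f⟶u) (yes (inj₁ f⟶u)) _ _ = contradiction f⟶u ¬f⟶u
      classify (no ¬f⟶u) (yes (inj₂ _)) (yes pay) _ = inj₂ (fair-paying pay)
      classify (no ¬f⟶u) (yes (inj₂ f⟶⟶u)) (no ¬pay) _ = inj₂ (fair-good ¬f⟶u (m≤n⇒m≤n+o _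
        (≤-reflexive (≡.sym (indicator-yes (kept? u) ((f⟶⟶u , ¬f⟶u) , ¬pay))))))
      classify (no ¬f⟶u) (no _) _ (yes gain) = inj₂ (fair-good ¬f⟶u (m≤n⇒m≤o+n _
        (≤-reflexive (≡.sym (indicator-yes (gained? u) gain)))))
      classify (no _) (no f⇏u) _ (no ¬gain) =
        inj₁ (u≢f , f⇏u , λ f⟶c c~u al → ¬gain (u≢f , f⇏u , _ , f⟶c , c~u , al))

    γ≤second : total γ (allFin n) ≤ total (indicator ∘ second?) (allFin n)
    γ≤second = begin
      total γ V
        ≡⟨ total-+ (indicator ∘ kept?) _ V ⟩
      total (indicator ∘ kept?) V + total (indicator ∘ gained?) V
        ≤⟨ +-monoʳ-≤ _ (total-injection gained? paying? (flip Pays) pays-injective gained⇒pays) ⟩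
      total (indicator ∘ kept?) V + total (indicator ∘ paying?) V
        ≡⟨ total-+ (indicator ∘ kept?) _ V ⟨
      total (λ u → indicator (kept? u) + indicator (paying? u)) V
        ≤⟨ total-mono (λ u → indicator-difference (second? u) (paying? u) paying⇒second) V ⟩
      total (indicator ∘ second?) V ∎
      where
      open ≤-Reasoning

      V : List (Fin n)
      V = allFin n

    d⁺≤d⁺⁺ : ∀ {l} → f ∷ l ↭ allFin n → LocalMedian (f ∷ l) → d⁺ D f ≤ d⁺⁺ D f
    d⁺≤d⁺⁺ {l} f∷l↭V (balanced , median) = begin
      d⁺ D f
        ≡⟨ ∣tabulate∣ (does ∘ arc? f) ⟩
      total α (allFin n)
        ≡⟨ total-↭ α f∷l↭V ⟨
      α f + total α l
        ≡⟨ cong (_+ total α l) (indicator-no (arc? f f) (loopless refl)) ⟩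
      total α l
        ≤⟨ feed (inj₁ refl) l 0 0 0 0 z≤n balanced median (All.map (cut⊎fair _ ∘ ≢-sym) f≢l) ⟩
      total γ l
        ≤⟨ m≤n+m _ (γ f) ⟩
      total γ (f ∷ l)
        ≡⟨ total-↭ γ f∷l↭V ⟩
      total γ (allFin n)
        ≤⟨ γ≤second ⟩
      total (indicator ∘ second?) (allFin n)
        ≡⟨ ∣tabulate∣ (does ∘ second?) ⟨
      d⁺⁺ D f ∎
      where
      open ≤-Reasoning

      unique : Unique (f ∷ l)
      unique = Permutation.Unique-resp-↭ (≡.setoid (Fin n)) (↭⇒↭ₛ (↭-sym f∷l↭V)) (allFin⁺ n)

      f≢l : All (f ≢_) l
      f≢l with f≢l ∷ _ ← unique = f≢l

  second-neighbourhood : .{{_ : NonZero n}} → ∃ λ v → d⁺ D v ≤ d⁺⁺ D v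
  second-neighbourhood with local-median (λ u v → indicator≤1 (u ⇝? v)) (allFin n)
  ... | f ∷ _ , f∷l↭V , median = f , FeedVertex.d⁺≤d⁺⁺ f f∷l↭V median
  ... | []    , []↭V  , _      =
    contradiction (≡.trans (≡.sym (length-tabulate id)) (≡.sym (↭-length []↭V))) (≢-nonZero⁻¹ n)

theorem7 : (n : ℕ) .{{_ : NonZero n}} (S : Subset n) (G : Graph (∃ (_∈ S))) → IsComb G →
    (D : Digraph n) → IsOriented D → IsMissing D S G →
    ∃ λ v → d⁺ D v ≤ d⁺⁺ D v
theorem7 n S G comb D oriented missing =
  CombMissing.second-neighbourhood S G comb D oriented missing
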